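{- For every positive integer $t$, there exists an integer $N$ such that if $G$ is a graph and the complete graph $K_{t+1}$ is not a minor of $G$, then $V(G)$ can be partitioned into $3t$ sets $X_1,X_2,\ldots,X_{3t}$ such that for each $1\le i\le 3t$, every connected component of the induced subgraph $G[X_i]$ has at most $N$ vertices.
   Context: All graphs are finite and simple. A graph $H$ is a minor of $G$ if a graph isomorphic to $H$ can be obtained from a subgraph of $G$ by contracting edges. $G[X]$ denotes the subgraph of $G$ induced on $X$. -}

module Defs where

open import Data.Nat using (ℕ; _≤_)
open import Data.Fin using (Fin; _≟_)
open import Data.Bool using (Bool; true; false; not)
open import Data.Maybe using (Maybe; just)
open import Data.List using (List; length)
open import Data.List.Membership.Propositional using (_∈_)
open import Data.Product using (Σ; ∃; _×_; _,_)
open import Relation.Nullary using (yes; no; does)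
open import Relation.Binary.PropositionalEquality using (_≡_; refl; sym; cong)

record Graph : Set where
  field
    n      : ℕ
    adj    : Fin n → Fin n → Bool
    adj-sym     : ∀ u v → adj u v ≡ adj v u
    adj-irrefl  : ∀ v → adj v v ≡ false
open Graph public

V : Graph → Set
V G = Fin (n G)

data Walk (G : Graph) (X : V G → Set) : V G → V G → Set where
  here : ∀ {u} → X u → Walk G X u u
  step : ∀ {u w v} → X u → adj G u w ≡ true → Walk G X w v → Walk G X u v

Connected : (G : Graph) → (V G → Set) → Set
Connected G X = ∀ u v → X u → X v → Walk G X u v

-- H is a minor of G, via a minor model: φ v = just h means v lies in the
-- branch set of h; branch sets are automatically pairwise disjoint, each is
-- nonempty and induces a connected subgraph, and adjacent vertices of H have
-- adjacent branch sets.
IsMinor : Graph → Graph → Set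
IsMinor H G =
  Σ (V G → Maybe (V H)) λ φ →
    (∀ h → ∃ λ v → φ v ≡ just h)
  × (∀ h → Connected G (λ v → φ v ≡ just h))
  × (∀ h h' → adj H h h' ≡ true →
       ∃ λ u → ∃ λ v → φ u ≡ just h × φ v ≡ just h' × adj G u v ≡ true)

private
  ≟-sym : ∀ {m} (i j : Fin m) → does (i ≟ j) ≡ does (j ≟ i)
  ≟-sym i j with i ≟ j | j ≟ i
  ... | yes _ | yes _ = refl
  ... | no _  | no _  = refl
  ... | yes p | no q  with q (sym p)
  ... | ()
  ≟-sym i j | no p | yes q with p (sym q)
  ... | ()

  ≟-refl : ∀ {m} (i : Fin m) → not (does (i ≟ i)) ≡ false
  ≟-refl i with i ≟ i
  ... | yes _ = refl
  ... | no p with p refl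
  ... | ()

K : ℕ → Graph
K m = record
  { n = m
  ; adj = λ i j → not (does (i ≟ j))
  ; adj-sym = λ i j → cong not (≟-sym i j)
  ; adj-irrefl = ≟-refl
  }

ComponentsAtMost : (G : Graph) → (V G → Set) → ℕ → Set
ComponentsAtMost G X N =
  ∀ v → X v → ∃ λ (L : List (V G)) → length L ≤ N × (∀ w → Walk G X v w → w ∈ L)

{-# OPTIONS --safe #-}
module Submission where

-- Label the vertices part by part, keeping every part connected and the parts that are seen from a
-- common component of the unlabelled vertices pairwise adjacent. Let C be such a component and v ∈ C.
-- Parts seen from C have distinct colours, and if all t colours occur, contracting C and these parts
-- gives K_{t+1}. Otherwise the new part is a union of at most t geodesics of C from v, one to a
-- vertex adjacent to each part seen from C; it takes a free colour, and its vertices are layered by their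
-- distance from v. A layer has at most one vertex per geodesic, and an edge within a part joins equal
-- or consecutive layers, so the colour together with the parity of the layer uses 2t colours and
-- each monochromatic component lies in a single layer of a single part. The third class of each
-- colour stays empty.

open import Defs
open import Data.Bool using (true)
open import Data.Bool.Properties using () renaming (_≟_ to _≟ᵇ_)
open import Data.Fin using (Fin; zero; suc; combine; toℕ)
open import Data.Fin.Properties using (_≟_; any?; all?; ¬∀⟶∃¬; pigeonhole; combine-injective)
open import Data.List using (List; []; _∷_; length; tabulate; allFin)
open import Data.List.Membership.Propositional using (_∈_)
open import Data.List.Membership.Propositional.Properties using (∈-tabulate⁺; ∈-allFin)
open import Data.List.Properties using (length-tabulate)
open import Data.List.Relation.Unary.Any using (here; there)
open import Data.Maybe using (Maybe; just; nothing)
open import Data.Nat using (ℕ; zero; suc; _*_; _∸_; _≤_; _<_; z≤n; s≤s; s≤s⁻¹; _≤?_)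
open import Data.Nat.GeneralisedArithmetic using (fold)
open import Data.Nat.Properties
  using (≤-refl; ≤-reflexive; ≤-trans; ≤-antisym; m≤n⇒m≤1+n; m≤n⇒m<n∨m≡n; n<1+n; ≰⇒>; <⇒≱; <-cmp;
         m≤n⇒m∸n≡0; +-∸-assoc; n∸n≡0; suc-injective)
  renaming (_≟_ to _≟ℕ_)
open import Data.Product using (∃; _×_; _,_; proj₁; proj₂)
open import Data.Product.Properties using () renaming (≡-dec to ×-≡-dec)
open import Data.Sum using (_⊎_; inj₁; inj₂)
open import Function using (_∘_)
open import Relation.Binary.Definitions using (DecidableEquality; tri<; tri≈; tri>)
open import Relation.Binary.PropositionalEquality
  using (_≡_; _≢_; refl; sym; trans; cong; subst)
open import Relation.Nullary using (Dec; yes; no; ¬_; ¬?; contradiction; _×-dec_; _⊎-dec_)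
open import Relation.Nullary.Decidable using (decidable-stable)
open import Relation.Unary using (Decidable; _⊆_)

-- Walks and connectedness

adj-swap : ∀ (G : Graph) {u w} → adj G u w ≡ true → adj G w u ≡ true
adj-swap G {u} {w} e = trans (adj-sym G w u) e

module _ {G : Graph} {X : V G → Set} where

  walk-map : ∀ {Y : V G → Set} {u w} → X ⊆ Y → Walk G X u w → Walk G Y u w
  walk-map f (here x)     = here (f x)
  walk-map f (step x e p) = step (f x) e (walk-map f p)

  _++ʷ_ : ∀ {u v w} → Walk G X u v → Walk G X v w → Walk G X u w
  here _     ++ʷ q = q
  step x e p ++ʷ q = step x e (p ++ʷ q)

  walk-start : ∀ {u w} → Walk G X u w → X u
  walk-start (here x)     = x
  walk-start (step x _ _) = x

  walk-reverse : ∀ {u w} → Walk G X u w → Walk G X w u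
  walk-reverse (here x)     = here x
  walk-reverse (step x e p) = walk-reverse p ++ʷ step (walk-start p) (adj-swap G e) (here x)

  walk-closed : ∀ {Y : V G → Set} → (∀ {u w} → Y u → X w → adj G u w ≡ true → Y w) →
                ∀ {u w} → Walk G X u w → Y u → Y w
  walk-closed f (here _)     y = y
  walk-closed f (step _ e p) y = walk-closed f p (f y (walk-start p) e)

  connected-via : ∀ r → (∀ u → X u → Walk G X u r) → Connected G X
  connected-via r toRoot u w xu xw = toRoot u xu ++ʷ walk-reverse (toRoot w xw)

-- Breadth-first trees

record BFSTree (G : Graph) (S : V G → Set) (root : V G) : Set₁ where
  field
    Reach          : V G → Set
    reach?         : Decidable Reach
    depth          : V G → ℕ
    parent         : V G → V G
    reach⊆         : Reach ⊆ S
    root-reach     : Reach root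
    reach-closed   : ∀ {u w} → Reach u → S w → adj G u w ≡ true → Reach w
    depth-adj      : ∀ {u w} → Reach u → Reach w → adj G u w ≡ true → depth w ≤ suc (depth u)
    depth-zero     : ∀ {u} → Reach u → depth u ≡ 0 → u ≡ root
    parent-reach   : ∀ {u} → Reach u → Reach (parent u)
    parent-depth   : ∀ {u d} → Reach u → depth u ≡ suc d → depth (parent u) ≡ d
    parent-adj     : ∀ {u d} → Reach u → depth u ≡ suc d → adj G u (parent u) ≡ true

  -- `k` needs no bound because `parent-reach` also covers the root, so climbing too far still stays
  -- inside `Reach`.
  ancestor-reach : ∀ {u} k → Reach u → Reach (fold u parent k)
  ancestor-reach zero    r = r
  ancestor-reach (suc k) r = parent-reach (ancestor-reach k r)

  -- Climbing parents lowers the depth by one each time and never leaves `X`, so every vertex of `X`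
  -- has a walk in `X` to the root. This serves both for a whole component and for a union of
  -- geodesics.
  parent-closed-connected : ∀ {X : V G → Set} → X ⊆ Reach →
    (∀ {u d} → X u → depth u ≡ suc d → X (parent u)) → Connected G X
  parent-closed-connected {X} X⊆ closed = connected-via root λ u → climb (depth u) u refl
    where
    climb : ∀ d u → depth u ≡ d → X u → Walk G X u root
    climb zero    u e x = subst (Walk G X u) (depth-zero (X⊆ x) e) (here x)
    climb (suc d) u e x = step x (parent-adj (X⊆ x) e)
      (climb d (parent u) (parent-depth (X⊆ x) e) (closed x e))

  reach-connected : Connected G Reach
  reach-connected = parent-closed-connected (λ r → r) (λ r _ → parent-reach r)

-- Breadth-first search by growing balls

module _ (G : Graph) {S : V G → Set} (S? : Decidable S) {root : V G} (S-root : S root) where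

  private
    -- The ball of radius `k` around `root` in the subgraph induced on `S`.
    Within : ℕ → V G → Set
    Within zero    u = u ≡ root
    Within (suc k) u = Within k u ⊎ (S u × ∃ λ w → Within k w × adj G w u ≡ true)

    within? : ∀ k → Decidable (Within k)
    within? zero    u = u ≟ root
    within? (suc k) u =
      within? k u ⊎-dec (S? u ×-dec any? λ w → within? k w ×-dec (adj G w u ≟ᵇ true))

    within-mono : ∀ {j} k → j ≤ k → Within j ⊆ Within k
    within-mono zero    z≤n i = i
    within-mono (suc k) j≤ i with m≤n⇒m<n∨m≡n j≤
    ... | inj₁ j<   = inj₁ (within-mono k (s≤s⁻¹ j<) i)
    ... | inj₂ refl = i

    within⊆ : ∀ k → Within k ⊆ S
    within⊆ zero    refl           = S-root
    within⊆ (suc k) (inj₁ i)       = within⊆ k i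
    within⊆ (suc k) (inj₂ (s , _)) = s

    within-root : ∀ k → Within k root
    within-root k = within-mono k z≤n refl

    Fresh : ℕ → V G → Set
    Fresh k u = Within (suc k) u × ¬ Within k u

    fresh? : ∀ k → Decidable (Fresh k)
    fresh? k u = within? (suc k) u ×-dec ¬? (within? k u)

    -- If every one of the first |V G| + 1 balls grew, two of the new vertices would coincide.
    saturation : ∃ λ k → Within (suc k) ⊆ Within k
    saturation with all? {suc (n G)} (λ k → any? (fresh? (toℕ k)))
    ... | yes grow with pigeonhole (n<1+n (n G)) (proj₁ ∘ grow)
    ...   | i , j , i<j , same =
      contradiction
        (within-mono (toℕ j) i<j (subst (Within (suc (toℕ i))) same (proj₁ (proj₂ (grow i)))))
        (proj₂ (proj₂ (grow j)))
    saturation | no ¬grow with ¬∀⟶∃¬ _ _ (λ k → any? (fresh? (toℕ k))) ¬grow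
    ... | k , ¬fresh = toℕ k ,
      λ {u} i → decidable-stable (within? (toℕ k) u) (λ ¬i → ¬fresh (u , i , ¬i))

    radius : ℕ
    radius = proj₁ saturation

    -- The least j ≤ k with Within j u; the junk value k when there is none.
    level : ℕ → V G → ℕ
    level zero    u = 0
    level (suc k) u with within? k u
    ... | yes _ = level k u
    ... | no _  = suc k

    level-within : ∀ k {u} → Within k u → Within (level k u) u
    level-within zero    i = i
    level-within (suc k) {u} i with within? k u
    ... | yes j = level-within k j
    ... | no _  = i

    level-least : ∀ k {j u} → Within j u → level k u ≤ j
    level-least zero    i = z≤n
    level-least (suc k) {j} {u} i with within? k u
    ... | yes _ = level-least k i
    ... | no ¬i with suc k ≤? j
    ...   | yes k<j = k<j
    ...   | no k≮j  = contradiction (within-mono k (s≤s⁻¹ (≰⇒> k≮j)) i) ¬i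

    Reach : V G → Set
    Reach = Within radius

    depth : V G → ℕ
    depth = level radius

    reach-closed : ∀ {u w} → Reach u → S w → adj G u w ≡ true → Reach w
    reach-closed r s e = proj₂ saturation (inj₂ (s , _ , r , e))

    depth-adj : ∀ {u w} → Reach u → Reach w → adj G u w ≡ true → depth w ≤ suc (depth u)
    depth-adj {u} ru rw e =
      level-least radius (inj₂ (within⊆ radius rw , u , level-within radius ru , e))

    IsParent : V G → V G → Set
    IsParent u w = Reach w × adj G w u ≡ true × suc (depth w) ≡ depth u

    parent? : ∀ u → Dec (∃ (IsParent u))
    parent? u = any? λ w →
      within? radius w ×-dec ((adj G w u ≟ᵇ true) ×-dec (suc (depth w) ≟ℕ depth u))

    parent-of : ∀ {u} → Dec (∃ (IsParent u)) → V G
    parent-of (yes (w , _)) = w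
    -- This default, taken at `root`, lies in `Reach`, as `parent-reach` demands.
    parent-of (no _)        = root

    -- A vertex at depth `suc d` entered the balls at step `suc d` through a neighbour `w` in the
    -- ball of radius `d`. So `w` has depth at most `d`, and `depth-adj` excludes anything smaller.
    has-parent : ∀ {u d} → Reach u → depth u ≡ suc d → ∃ (IsParent u)
    has-parent {u} {d} r e with subst (λ k → Within k u) e (level-within radius r)
    ... | inj₁ i = contradiction (subst (_≤ d) e (level-least radius i)) (<⇒≱ (n<1+n d))
    ... | inj₂ (_ , w , i , a) = w , rw , a ,
      ≤-antisym (subst (suc (depth w) ≤_) (sym e) (s≤s (level-least radius i))) (depth-adj rw r a)
      where
      -- `level` never exceeds its cut-off, hence the ball of radius `d` lies inside `Reach`.
      d<radius : ∀ k → level k u ≡ suc d → d < k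
      d<radius zero    ()
      d<radius (suc k) e′ with within? k u
      ... | yes _ = m≤n⇒m≤1+n (d<radius k e′)
      ... | no _  = ≤-reflexive (sym e′)
      rw : Reach w
      rw = within-mono radius (≤-trans (m≤n⇒m≤1+n ≤-refl) (d<radius radius e)) i

    parent-of-isParent : ∀ {u d} → Reach u → depth u ≡ suc d → (p : Dec (∃ (IsParent u))) →
                         IsParent u (parent-of p)
    parent-of-isParent r e (yes (_ , p)) = p
    parent-of-isParent r e (no ¬p)       = contradiction (has-parent r e) ¬p

    parent-of-reach : ∀ {u} (p : Dec (∃ (IsParent u))) → Reach (parent-of p)
    parent-of-reach (yes (_ , r , _)) = r
    parent-of-reach (no _)            = within-root radius

  bfsTree : BFSTree G S root
  bfsTree = record
    { Reach        = Reach
    ; reach?       = within? radius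
    ; depth        = depth
    ; parent       = λ u → parent-of (parent? u)
    ; reach⊆       = within⊆ radius
    ; root-reach   = within-root radius
    ; reach-closed = reach-closed
    ; depth-adj    = depth-adj
    ; depth-zero   = λ {u} r e → subst (λ k → Within k u) e (level-within radius r)
    ; parent-reach = λ {u} _ → parent-of-reach (parent? u)
    ; parent-depth = λ {u} r e →
        suc-injective (trans (proj₂ (proj₂ (parent-of-isParent r e (parent? u)))) e)
    ; parent-adj   = λ {u} r e → adj-swap G (proj₁ (proj₂ (parent-of-isParent r e (parent? u))))
    }

-- Complete graphs and labellings by connected parts

K-adj⇒≢ : ∀ m {i j : Fin m} → adj (K m) i j ≡ true → i ≢ j
K-adj⇒≢ m {i} {j} e with i ≟ j
K-adj⇒≢ m {i} {j} () | yes _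
... | no i≢j = i≢j

module _ (G : Graph) (t : ℕ) where

  -- A part is named by the vertex its tree was rooted at, together with its colour.
  Part : Set
  Part = V G × Fin t

  Labelling : Set
  Labelling = V G → Maybe (Part × ℕ)

  _≟ᵖ_ : DecidableEquality Part
  _≟ᵖ_ = ×-≡-dec _≟_ _≟_

  module _ (lab : Labelling) where

    Unlabelled : V G → Set
    Unlabelled u = lab u ≡ nothing

    In : Part → V G → Set
    In p u = ∃ λ d → lab u ≡ just (p , d)

    Touch : Part → Part → Set
    Touch p q = ∃ λ u → ∃ λ w → In p u × In q w × adj G u w ≡ true

    unlabelled? : Decidable Unlabelled
    unlabelled? u with lab u
    ... | nothing = yes refl
    ... | just _  = no λ ()

    -- `rooted` keeps the name of a part built from an unlabelled vertex fresh. `layered`, used in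
    -- both directions along an edge, makes its two layers differ by at most one. In `clique`, the
    -- walk from `u` to `u′` says that both parts are seen from one component of unlabelled
    -- vertices.
    record Valid : Set where
      field
        rooted  : ∀ {r c u} → In (r , c) u → ¬ Unlabelled r
        joined  : ∀ p → Connected G (In p)
        proper  : ∀ {p q u w} → In p u → In q w → adj G u w ≡ true → proj₂ p ≡ proj₂ q → p ≡ q
        layered : ∀ {p d e u w} → lab u ≡ just (p , d) → lab w ≡ just (p , e) →
                  adj G u w ≡ true → e ≤ suc d
        thin    : ∀ p d → ∃ λ (L : List (V G)) →
                  length L ≤ t × (∀ u → lab u ≡ just (p , d) → u ∈ L)
        clique  : ∀ {p q u u′ x x′} → Walk G Unlabelled u u′ →
                  adj G u x ≡ true → adj G u′ x′ ≡ true → In p x → In q x′ → p ≢ q → Touch p q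

  empty-valid : Valid (λ _ → nothing)
  empty-valid = record
    { rooted  = λ ()
    ; joined  = λ _ _ _ ()
    ; proper  = λ ()
    ; layered = λ ()
    ; thin    = λ _ _ → [] , z≤n , λ _ ()
    ; clique  = λ _ _ _ ()
    }

  -- Parts seen from an unlabelled component

  module Extension {lab : Labelling} (valid : Valid lab) {v : V G}
                   (tree : BFSTree G (Unlabelled lab) v) where
    open Valid valid
    open BFSTree tree

    HasColour : Fin t → V G → Set
    HasColour c u = ∃ λ r → In lab (r , c) u

    hasColour? : ∀ c → Decidable (HasColour c)
    hasColour? c u with lab u
    ... | nothing = no λ ()
    ... | just ((r , c′) , d) with c′ ≟ c
    ...   | yes refl = yes (r , d , refl)
    ...   | no c′≢c  = no λ { (_ , _ , refl) → c′≢c refl }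

    Used : Fin t → Set
    Used c = ∃ λ u → Reach u × ∃ λ x → adj G u x ≡ true × HasColour c x

    used? : Decidable Used
    used? c = any? λ u → reach? u ×-dec any? λ x → (adj G u x ≟ᵇ true) ×-dec hasColour? c x

    reach-walk : ∀ {u w} → Reach u → Reach w → Walk G (Unlabelled lab) u w
    reach-walk ru rw = walk-map reach⊆ (reach-connected _ _ ru rw)

    -- The branch sets are the component `Reach` and, for each colour, the part of that colour which
    -- `used` exhibits next to it.
    all-used⇒minor : (∀ c → Used c) → IsMinor (K (suc t)) G
    all-used⇒minor used = φ , nonempty , connected , adjacent
      where
      part : Fin t → Part
      part c = let (_ , _ , _ , _ , r , _) = used c in r , c

      φ : V G → Maybe (Fin (suc t))
      φ u with lab u
      φ u | nothing with reach? u
      ... | yes _ = just zero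
      ... | no _  = nothing
      -- A colour may occur on many parts; only the chosen one becomes a branch set.
      φ u | just (p , _) with p ≟ᵖ part (proj₂ p)
      ... | yes _ = just (suc (proj₂ p))
      ... | no _  = nothing

      Branch : Fin (suc t) → V G → Set
      Branch zero    = Reach
      Branch (suc c) = In lab (part c)

      φ⇒branch : ∀ h {u} → φ u ≡ just h → Branch h u
      φ⇒branch h {u} e with lab u in eq
      φ⇒branch h {u} e | nothing with reach? u
      φ⇒branch _ refl | nothing | yes r = r
      φ⇒branch h {u} e | just (p , d) with p ≟ᵖ part (proj₂ p)
      φ⇒branch _ {u} refl | just (p , d) | yes p≡ = d , trans eq (cong (λ q → just (q , d)) p≡)

      branch⇒φ : ∀ h {u} → Branch h u → φ u ≡ just h
      branch⇒φ zero {u} r rewrite reach⊆ r with reach? u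
      ... | yes _ = refl
      ... | no ¬r = contradiction r ¬r
      branch⇒φ (suc c) {u} (d , e) rewrite e with part c ≟ᵖ part c
      ... | yes _ = refl
      ... | no ≢  = contradiction refl ≢

      nonempty : ∀ h → ∃ λ u → φ u ≡ just h
      nonempty zero    = v , branch⇒φ zero root-reach
      nonempty (suc c) = let (_ , _ , x , _ , _ , i) = used c in x , branch⇒φ (suc c) i

      branch-connected : ∀ h → Connected G (Branch h)
      branch-connected zero    = reach-connected
      branch-connected (suc c) = joined (part c)

      connected : ∀ h → Connected G (λ u → φ u ≡ just h)
      connected h u w eu ew =
        walk-map (branch⇒φ h) (branch-connected h u w (φ⇒branch h eu) (φ⇒branch h ew))

      branch-adjacent : ∀ h h′ → h ≢ h′ →
        ∃ λ u → ∃ λ w → Branch h u × Branch h′ w × adj G u w ≡ true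
      branch-adjacent zero zero ≢ = contradiction refl ≢
      branch-adjacent zero (suc c) _ =
        let (u , r , x , a , _ , i) = used c in u , x , r , i , a
      branch-adjacent (suc c) zero _ =
        let (u , r , x , a , _ , i) = used c in x , u , i , r , adj-swap G a
      branch-adjacent (suc c) (suc c′) ≢ =
        let (u , r , x , a , _ , i)       = used c
            (u′ , r′ , x′ , a′ , _ , i′) = used c′
        -- Both parts are seen from `Reach`, and different colours make them different parts.
        in clique (reach-walk r r′) a a′ i i′ (≢ ∘ cong suc ∘ cong proj₂)

      adjacent : ∀ h h′ → adj (K (suc t)) h h′ ≡ true →
        ∃ λ u → ∃ λ w → φ u ≡ just h × φ w ≡ just h′ × adj G u w ≡ true
      adjacent h h′ e with branch-adjacent h h′ (K-adj⇒≢ (suc t) e)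
      ... | u , w , b , b′ , a = u , w , branch⇒φ h b , branch⇒φ h′ b′ , a

    -- The new part as a union of geodesics

    module WithFreeColour {free : Fin t} (¬used : ¬ Used free) where

      terminal-of : ∀ {c} → Dec (Used c) → V G
      terminal-of (yes (u , _)) = u
      terminal-of (no _)        = v

      terminal : Fin t → V G
      terminal c = terminal-of (used? c)

      terminal-reach : ∀ c → Reach (terminal c)
      terminal-reach c with used? c
      ... | yes (_ , r , _) = r
      ... | no _            = root-reach

      terminal-adj : ∀ {c} → Used c → ∃ λ x → adj G (terminal c) x ≡ true × HasColour c x
      terminal-adj {c} used with used? c
      ... | yes (_ , _ , x) = x
      ... | no ¬u           = contradiction used ¬u

      terminal-free : terminal free ≡ v
      terminal-free with used? free
      ... | yes u = contradiction u ¬used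
      ... | no _  = refl

      -- The ancestor of the terminal at depth `d`. Beyond the depth of the terminal, truncated
      -- subtraction gives the terminal itself. Indexing by depth lets each layer be listed with one
      -- entry per colour.
      geodesic : Fin t → ℕ → V G
      geodesic c d = fold (terminal c) parent (depth (terminal c) ∸ d)

      NewPart : V G → Set
      NewPart u = ∃ λ c → geodesic c (depth u) ≡ u

      newPart? : Decidable NewPart
      newPart? u = any? λ c → geodesic c (depth u) ≟ u

      new⊆reach : NewPart ⊆ Reach
      new⊆reach {u} (c , e) = subst Reach e
        (ancestor-reach (depth (terminal c) ∸ depth u) (terminal-reach c))

      terminal-new : ∀ c → NewPart (terminal c)
      terminal-new c = c , cong (fold (terminal c) parent) (n∸n≡0 (depth (terminal c)))

      root-new : NewPart v
      root-new = subst NewPart terminal-free (terminal-new free)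

      new-connected : Connected G NewPart
      new-connected = parent-closed-connected new⊆reach closed
        where
        closed : ∀ {u d} → NewPart u → depth u ≡ suc d → NewPart (parent u)
        closed {u} {d} i@(c , on) du =
          c , trans (cong (geodesic c) (parent-depth (new⊆reach i) du)) on-geodesic
          where
          l = depth (terminal c)
          e : geodesic c (suc d) ≡ u
          e = subst (λ k → geodesic c k ≡ u) du on
          on-geodesic : geodesic c d ≡ parent u
          on-geodesic with suc d ≤? l
          -- `l ∸ d` is one more than `l ∸ suc d`, so the geodesic takes one further parent step
          -- from `u`.
          ... | yes d<l = trans (cong (fold (terminal c) parent) (+-∸-assoc 1 d<l)) (cong parent e)
          -- Here the truncated subtraction is zero, so `u` is the terminal itself, whose depth `l`
          -- would then be `suc d`.
          ... | no d≮l  = contradiction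
            (≤-reflexive (trans (sym du) (cong depth (sym terminal≡u)))) d≮l
            where
            terminal≡u : terminal c ≡ u
            terminal≡u = trans
              (cong (fold (terminal c) parent) (sym (m≤n⇒m∸n≡0 (m≤n⇒m≤1+n (s≤s⁻¹ (≰⇒> d≮l)))))) e

      -- The extended labelling and its invariants

      new : Part
      new = v , free

      lab⁺ : Labelling
      lab⁺ u with newPart? u
      ... | yes _ = just (new , depth u)
      ... | no _  = lab u

      data View (u : V G) (p : Part) (d : ℕ) : Set where
        is-new : NewPart u → p ≡ new → d ≡ depth u → View u p d
        is-old : lab u ≡ just (p , d) → View u p d

      view : ∀ {u p d} → lab⁺ u ≡ just (p , d) → View u p d
      view {u} e with newPart? u
      view refl | yes i = is-new i refl refl
      view e    | no _  = is-old e

      lab⁺-new : ∀ {u} → NewPart u → lab⁺ u ≡ just (new , depth u)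
      lab⁺-new {u} i with newPart? u
      ... | yes _ = refl
      ... | no ¬i = contradiction i ¬i

      lab⁺-old : ∀ {u l} → lab u ≡ just l → lab⁺ u ≡ just l
      lab⁺-old {u} e with newPart? u
      ... | no _  = e
      ... | yes i with () ← trans (sym e) (reach⊆ (new⊆reach i))

      unlabelled⁺ : Unlabelled lab⁺ ⊆ Unlabelled lab
      unlabelled⁺ {u} e with newPart? u
      ... | no _ = e

      root-labelled⁺ : ¬ Unlabelled lab⁺ v
      root-labelled⁺ e with () ← trans (sym e) (lab⁺-new root-new)

      -- The root of an old part is labelled by `rooted`, whereas `v` is still unlabelled in `lab`.
      new-not-old : ∀ {p u d} → lab u ≡ just (p , d) → p ≢ new
      new-not-old e refl = rooted (_ , e) (reach⊆ root-reach)

      touch-old : ∀ {p q} → Touch lab p q → Touch lab⁺ p q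
      touch-old (u , w , (_ , iu) , (_ , iw) , a) =
        u , w , (_ , lab⁺-old iu) , (_ , lab⁺-old iw) , a

      used-by : ∀ {u x p d} → Reach u → adj G u x ≡ true → lab x ≡ just (p , d) → Used (proj₂ p)
      used-by r a e = _ , r , _ , a , _ , _ , e

      rooted⁺ : ∀ {r c u} → In lab⁺ (r , c) u → ¬ Unlabelled lab⁺ r
      rooted⁺ (d , e) with view e
      ... | is-new _ refl _ = root-labelled⁺
      ... | is-old e′       = rooted (d , e′) ∘ unlabelled⁺

      joined⁺ : ∀ p → Connected G (In lab⁺ p)
      joined⁺ p u w (d , eu) (d′ , ew) with view eu | view ew
      ... | is-new iu refl _ | is-new iw _ _ =
        walk-map (λ i → _ , lab⁺-new i) (new-connected u w iu iw)
      ... | is-new _ p≡ _ | is-old o      = contradiction p≡ (new-not-old o)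
      ... | is-old o      | is-new _ p≡ _ = contradiction p≡ (new-not-old o)
      ... | is-old ou     | is-old ow     =
        walk-map (λ (d , e) → d , lab⁺-old e) (joined p u w (d , ou) (d′ , ow))

      proper⁺ : ∀ {p q u w} → In lab⁺ p u → In lab⁺ q w → adj G u w ≡ true →
                proj₂ p ≡ proj₂ q → p ≡ q
      proper⁺ (_ , eu) (_ , ew) a c≡ with view eu | view ew
      ... | is-new _ refl _  | is-new _ refl _  = refl
      ... | is-new iu refl _ | is-old ow        =
        -- An old neighbour of the free colour would make `free` used.
        contradiction (subst Used (sym c≡) (used-by (new⊆reach iu) a ow)) ¬used
      ... | is-old ou        | is-new iw refl _ =
        contradiction (subst Used c≡ (used-by (new⊆reach iw) (adj-swap G a) ou)) ¬used
      ... | is-old ou        | is-old ow        = proper (_ , ou) (_ , ow) a c≡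

      layered⁺ : ∀ {p d e u w} → lab⁺ u ≡ just (p , d) → lab⁺ w ≡ just (p , e) →
                 adj G u w ≡ true → e ≤ suc d
      layered⁺ eu ew a with view eu | view ew
      ... | is-new iu _ refl | is-new iw _ refl = depth-adj (new⊆reach iu) (new⊆reach iw) a
      ... | is-new _ p≡ _    | is-old o         = contradiction p≡ (new-not-old o)
      ... | is-old o         | is-new _ p≡ _    = contradiction p≡ (new-not-old o)
      ... | is-old ou        | is-old ow        = layered ou ow a

      thin⁺ : ∀ p d → ∃ λ (L : List (V G)) →
              length L ≤ t × (∀ u → lab⁺ u ≡ just (p , d) → u ∈ L)
      thin⁺ p d with p ≟ᵖ new
      ... | yes p≡new =
        layer , ≤-reflexive (length-tabulate (λ c → geodesic c d)) , covers
        where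
        layer : List (V G)
        layer = tabulate (λ c → geodesic c d)
        covers : ∀ u → lab⁺ u ≡ just (p , d) → u ∈ layer
        covers u e with view e
        ... | is-new (c , on) _ refl = subst (_∈ layer) on (∈-tabulate⁺ {f = λ c → geodesic c d} c)
        ... | is-old o               = contradiction p≡new (new-not-old o)
      ... | no p≢new with thin p d
      ...   | L , short , covers = L , short , covers⁺
        where
        covers⁺ : ∀ u → lab⁺ u ≡ just (p , d) → u ∈ L
        covers⁺ u e with view e
        ... | is-new _ p≡ _ = contradiction p≡ p≢new
        ... | is-old o      = covers u o

      -- The terminal of q's colour is adjacent to an old part of that colour; both it and q
      -- touch the reached set, so if they differed they would touch and violate properness.
      new-touches : ∀ {q u x} → Reach u → adj G u x ≡ true → In lab q x → Touch lab⁺ new q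
      new-touches {q} r a i@(_ , e) with terminal-adj (used-by r a e)
      ... | y , ty , s , j with (s , proj₂ q) ≟ᵖ q
      ...   | yes refl =
        _ , y , (_ , lab⁺-new (terminal-new (proj₂ q))) , (_ , lab⁺-old (proj₂ j)) , ty
      ...   | no ≢q with clique (reach-walk (terminal-reach (proj₂ q)) r) ty a j i ≢q
      ...     | _ , _ , k , l , kl = contradiction (proper k l kl refl) ≢q

      touch-sym : ∀ {p q} → Touch lab⁺ p q → Touch lab⁺ q p
      touch-sym (u , w , i , j , a) = w , u , j , i , adj-swap G a

      -- `x` lies in `Reach`, and its neighbour `u` was unlabelled before as well; hence the whole
      -- walk runs inside the old component.
      reach-end : ∀ {u u′ x} → Walk G (Unlabelled lab⁺) u u′ → adj G u x ≡ true → NewPart x →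
                  Reach u′
      reach-end walk a i = walk-closed reach-closed walk′
        (reach-closed (new⊆reach i) (walk-start walk′) (adj-swap G a))
        where walk′ = walk-map unlabelled⁺ walk

      -- Labelling more vertices only splits components, so two old parts are handled by `clique`.
      -- If one part is new, the other is seen from `Reach` and `new-touches` applies.
      clique⁺ : ∀ {p q u u′ x x′} → Walk G (Unlabelled lab⁺) u u′ →
                adj G u x ≡ true → adj G u′ x′ ≡ true →
                In lab⁺ p x → In lab⁺ q x′ → p ≢ q → Touch lab⁺ p q
      clique⁺ walk a a′ (_ , e) (_ , e′) p≢q with view e | view e′
      ... | is-new _ p≡ _   | is-new _ q≡ _   = contradiction (trans p≡ (sym q≡)) p≢q
      ... | is-new i refl _ | is-old o        = new-touches (reach-end walk a i) a′ (_ , o)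
      ... | is-old o        | is-new i refl _ =
        touch-sym (new-touches (reach-end (walk-reverse walk) a′ i) a (_ , o))
      ... | is-old o        | is-old o′       =
        touch-old (clique (walk-map unlabelled⁺ walk) a a′ (_ , o) (_ , o′) p≢q)

      valid⁺ : Valid lab⁺
      valid⁺ = record
        { rooted  = rooted⁺
        ; joined  = joined⁺
        ; proper  = proper⁺
        ; layered = layered⁺
        ; thin    = thin⁺
        ; clique  = clique⁺
        }

  -- Labelling every vertex

  module _ (noMinor : ¬ IsMinor (K (suc t)) G) where

    extend : ∀ {lab v} → Valid lab → BFSTree G (Unlabelled lab) v →
             ∃ λ lab⁺ → Valid lab⁺ × ¬ Unlabelled lab⁺ v × Unlabelled lab⁺ ⊆ Unlabelled lab
    extend valid tree with all? (Extension.used? valid tree)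
    ... | yes used = contradiction (Extension.all-used⇒minor valid tree used) noMinor
    ... | no ¬all with ¬∀⟶∃¬ t _ (Extension.used? valid tree) ¬all
    ...   | _ , ¬used = lab⁺ , valid⁺ , root-labelled⁺ , unlabelled⁺
      where open Extension.WithFreeColour valid tree ¬used

    -- An extension never removes a label, so the vertices treated earlier stay labelled.
    label-all : (us : List (V G)) →
                ∃ λ lab → Valid lab × (∀ {u} → u ∈ us → ¬ Unlabelled lab u)
    label-all [] = _ , empty-valid , λ ()
    label-all (v ∷ us) with label-all us
    ... | lab , valid , done with unlabelled? lab v
    ...   | no labelled = lab , valid , λ { (here refl) → labelled ; (there i) → done i }
    ...   | yes un with extend valid (bfsTree G (unlabelled? lab) un)
    ...     | lab⁺ , valid⁺ , v-done , mono =
      lab⁺ , valid⁺ , λ { (here refl) → v-done ; (there i) → done i ∘ mono }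

    labelling : ∃ λ lab → Valid lab × (∀ u → ∃ λ l → lab u ≡ just l)
    labelling with label-all (allFin (n G))
    ... | lab , valid , done = lab , valid , λ u → labelled u (done (∈-allFin u))
      where
      labelled : ∀ u → ¬ Unlabelled lab u → ∃ λ l → lab u ≡ just l
      labelled u ¬un with lab u
      ... | just l  = l , refl
      ... | nothing = contradiction refl ¬un

-- Colouring by part colour and parity of the layer

-- The codomain is `Fin 3` so that `combine` lands in `Fin (3 * t)`; the value two is never taken.
parity : ℕ → Fin 3
parity zero          = zero
parity (suc zero)    = suc zero
parity (suc (suc d)) = parity d

parity-suc : ∀ d → parity d ≢ parity (suc d)
parity-suc (suc (suc d)) e = parity-suc d e

parity-≡ : ∀ {d e} → d ≤ suc e → e ≤ suc d → parity d ≡ parity e → d ≡ e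
parity-≡ {d} {e} d≤ e≤ p≡ with <-cmp d e
... | tri≈ _ d≡e _ = d≡e
... | tri< d<e _ _ with refl ← ≤-antisym d<e e≤ = contradiction p≡ (parity-suc d)
... | tri> _ _ e<d with refl ← ≤-antisym e<d d≤ = contradiction (sym p≡) (parity-suc e)

theorem1p8 : (t : ℕ) → 1 ≤ t → ∃ λ (N : ℕ) →
    (G : Graph) → ¬ IsMinor (K (suc t)) G →
    ∃ λ (c : V G → Fin (3 * t)) →
    (i : Fin (3 * t)) → ComponentsAtMost G (λ v → c v ≡ i) N
-- `N` is `t`, the bound that `thin` puts on a layer of a part.
theorem1p8 t _ = t , λ G noMinor → clustered G (labelling G t noMinor)
  where
  clustered : (G : Graph) → (∃ λ lab → Valid G t lab × (∀ u → ∃ λ l → lab u ≡ just l)) →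
              ∃ λ (c : V G → Fin (3 * t)) →
              (i : Fin (3 * t)) → ComponentsAtMost G (λ v → c v ≡ i) t
  clustered G (lab , valid , labelled) = colour , component
    where
    open Valid valid

    label : V G → Part G t × ℕ
    label u = proj₁ (labelled u)

    lab≡ : ∀ u → lab u ≡ just (label u)
    lab≡ u = proj₂ (labelled u)

    colour : V G → Fin (3 * t)
    colour u = let ((_ , c) , d) = label u in combine (parity d) c

    -- Equal colours force equal parts by `proper`. Then `layered` in both directions brings the
    -- layers within one of each other, and equal parity makes them equal.
    same-label : ∀ {u w p q d e} → lab u ≡ just (p , d) → lab w ≡ just (q , e) →
                 adj G u w ≡ true → combine (parity d) (proj₂ p) ≡ combine (parity e) (proj₂ q) →
                 (p , d) ≡ (q , e)
    same-label {p = p} {q} {d} {e} lu lw a same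
      with combine-injective (parity d) (proj₂ p) (parity e) (proj₂ q) same
    ... | parity≡ , c≡ with refl ← proper (d , lu) (e , lw) a c≡ =
      cong (p ,_) (parity-≡ (layered lw lu (adj-swap G a)) (layered lu lw a) parity≡)

    label-walk : ∀ {i u w} → Walk G (λ v → colour v ≡ i) u w → label u ≡ label w
    label-walk (here _)     = refl
    label-walk (step x a p) =
      trans (same-label (lab≡ _) (lab≡ _) a (trans x (sym (walk-start p)))) (label-walk p)

    component : ∀ i → ComponentsAtMost G (λ v → colour v ≡ i) t
    -- Labels are constant along a monochromatic walk, so the list for the layer of `v` contains its
    -- whole component.
    component i v _ with thin (proj₁ (label v)) (proj₂ (label v))
    ... | L , short , covers =
      L , short , λ w walk → covers w (trans (lab≡ w) (cong just (sym (label-walk walk))))
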